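{- There exists a graph $G$ on $19$ vertices which is both $B_3$-free and $K_4$-free and satisfies $G \rightarrow (3,3)^v$. Consequently $F_v(K_3,K_3;B_3) \le 19$.
   Context: All graphs are finite, undirected and simple. $K_n$ is the complete graph on $n$ vertices. The join $G+H$ of vertex-disjoint graphs is their union together with all edges between $V(G)$ and $V(H)$. The book graph $B_k$ is $K_1 + K_{1,k}$ ($k$ triangles sharing a common edge); so $B_3$ has $5$ vertices. A graph is $H$-free if it contains no subgraph isomorphic to $H$. $G \rightarrow (3,3)^v$ means every red-blue coloring of the vertices of $G$ contains a monochromatic triangle $K_3$. $F_v(K_3,K_3;H)$ is the smallest $n$ such that some $H$-free graph on $n$ vertices satisfies $G \rightarrow (3,3)^v$. -}

module Defs where

open import Data.Nat using (ℕ; _≤_)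
open import Data.Fin using (Fin; zero; suc)
open import Data.Bool using (Bool; true; false)
open import Data.Product using (Σ; ∃; _×_; _,_)
open import Relation.Binary.PropositionalEquality using (_≡_)
open import Relation.Nullary using (¬_)
open import Function.Definitions using (Injective)

record Graph (n : ℕ) : Set where
  field
    adj   : Fin n → Fin n → Bool
    adj-sym : ∀ i j → adj i j ≡ adj j i
    adj-irrefl : ∀ i → adj i i ≡ false
open Graph public

Edge : ∀ {n} → Graph n → Fin n → Fin n → Set
Edge G i j = adj G i j ≡ true

Contains : ∀ {n k} → Graph n → Graph k → Set
Contains {n} {k} G H =
  Σ (Fin k → Fin n) λ f → Injective _≡_ _≡_ f × (∀ i j → Edge H i j → Edge G (f i) (f j))

Free : ∀ {n k} → Graph k → Graph n → Set
Free H G = ¬ Contains G H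

open import Data.Fin using (_≟_)
open import Relation.Nullary using (yes; no)
open import Relation.Binary.PropositionalEquality using (refl; sym)
open import Relation.Nullary.Decidable using (⌊_⌋)
open import Data.Bool using (not)

K : (k : ℕ) → Graph k
K k = record { adj = λ i j → not ⌊ i ≟ j ⌋ ; adj-sym = s ; adj-irrefl = r }
  where
  s : ∀ i j → not ⌊ i ≟ j ⌋ ≡ not ⌊ j ≟ i ⌋
  s i j with i ≟ j | j ≟ i
  ... | yes _ | yes _ = refl
  ... | no _  | no _  = refl
  ... | yes p | no q  = Data.Empty.⊥-elim (q (sym p))
    where import Data.Empty
  ... | no q  | yes p = Data.Empty.⊥-elim (q (sym p))
    where import Data.Empty
  r : ∀ i → not ⌊ i ≟ i ⌋ ≡ false
  r i with i ≟ i
  ... | yes _ = refl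
  ... | no q  = Data.Empty.⊥-elim (q refl)
    where import Data.Empty

-- Book graph B_3 = K_1 + K_{1,3}: vertices 0,1 form the spine edge,
-- vertices 2,3,4 are the pages; edges: 0-1, and {0,1}-{2,3,4}.
-- Explicit adjacency on Fin 5 (the only non-edges are among 2,3,4 and loops).
b3 : Fin 5 → Fin 5 → Bool
b3 zero zero = false
b3 zero (suc _) = true
b3 (suc zero) zero = true
b3 (suc zero) (suc zero) = false
b3 (suc zero) (suc (suc _)) = true
b3 (suc (suc _)) zero = true
b3 (suc (suc _)) (suc zero) = true
b3 (suc (suc _)) (suc (suc _)) = false

B₃ : Graph 5
B₃ = record { adj = b3 ; adj-sym = s ; adj-irrefl = r }
  where
  s : ∀ i j → b3 i j ≡ b3 j i
  s zero zero = refl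
  s zero (suc zero) = refl
  s zero (suc (suc _)) = refl
  s (suc zero) zero = refl
  s (suc zero) (suc zero) = refl
  s (suc zero) (suc (suc _)) = refl
  s (suc (suc _)) zero = refl
  s (suc (suc _)) (suc zero) = refl
  s (suc (suc _)) (suc (suc _)) = refl
  r : ∀ i → b3 i i ≡ false
  r zero = refl
  r (suc zero) = refl
  r (suc (suc _)) = refl

MonoTriangle : ∀ {n} → Graph n → (Fin n → Bool) → Set
MonoTriangle {n} G c =
  Σ (Fin n) λ x → Σ (Fin n) λ y → Σ (Fin n) λ z →
    Edge G x y × Edge G y z × Edge G x z ×
    c x ≡ c y × c y ≡ c z

Arrows33v : ∀ {n} → Graph n → Set
Arrows33v {n} G = (c : Fin n → Bool) → MonoTriangle G c

{-# OPTIONS --safe #-}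
-- The witness has an automorphism of order 9 with vertex orbits {aᵢ}, {bᵢ}
-- (i ∈ ℤ/9) and {∞}; its edges are aᵢaᵢ₊₃, aᵢaᵢ₊₄, bᵢbᵢ₊₁, aᵢbᵢ, aᵢbᵢ₊₁,
-- aᵢbᵢ₊₄ and bᵢ∞, and it was found by a computer search among the graphs with
-- such an automorphism.  Freeness is a finite check, and the arrowing property
-- is decided by a backtracking search over partial colourings that abandons a
-- branch as soon as a monochromatic triangle appears (about 4000 nodes).
module Submission where

open import Defs
open import Data.Bool using (Bool; true; false)
import Data.Bool.Properties as Bool
open import Data.Empty using (⊥)
open import Data.Fin using (Fin; toℕ; _≟_; #_)
open import Data.Fin.Properties using (all?)
open import Data.List using (List; []; _∷_; allFin)
open import Data.List.Membership.Propositional using (find)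
open import Data.List.Relation.Unary.All using (All; []; _∷_; lookup)
open import Data.List.Relation.Unary.Any using (Any; any?)
open import Data.Nat using (ℕ; _≤_; _+_; _∸_)
open import Data.Nat.DivMod using (_/_; _%_)
open import Data.Nat.Properties using (≤-refl)
open import Data.Product using (Σ; _×_; _,_)
open import Data.Sum using (_⊎_; inj₁; inj₂)
open import Relation.Binary.PropositionalEquality using (_≡_; refl; sym; trans)
open import Relation.Nullary using (Dec; no; ¬_)
open import Relation.Nullary.Decidable using (toWitness; _×-dec_; _⊎-dec_; _→-dec_; ¬?)

module _ {n} (G : Graph n) where

  edge? : ∀ i j → Dec (Edge G i j)
  edge? i j = adj G i j Bool.≟ true

  -- Each adjacency hypothesis directly follows the vertex it restricts, so the decision procedure
  -- leaves non-neighbours before entering the inner quantifiers.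
  NoThreeCommonNeighbours : Set
  NoThreeCommonNeighbours =
    ∀ a b → Edge G a b →
    ∀ x → Edge G a x → Edge G b x →
    ∀ y → Edge G a y → Edge G b y →
    ∀ z → Edge G a z → Edge G b z →
    x ≡ y ⊎ x ≡ z ⊎ y ≡ z

  noThreeCommonNeighbours? : Dec NoThreeCommonNeighbours
  noThreeCommonNeighbours? =
    all? λ a → all? λ b → edge? a b →-dec
    (all? λ x → edge? a x →-dec (edge? b x →-dec
    (all? λ y → edge? a y →-dec (edge? b y →-dec
    (all? λ z → edge? a z →-dec (edge? b z →-dec
    (x ≟ y ⊎-dec x ≟ z ⊎-dec y ≟ z)))))))

  -- The pages 2, 3, 4 of `B₃` map to common neighbours of the ends of the spine 0-1, and
  -- injectivity keeps them distinct.
  noThreeCommonNeighbours⇒B₃-free : NoThreeCommonNeighbours → Free B₃ G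
  noThreeCommonNeighbours⇒B₃-free h (f , f-inj , f-edge)
    with h (f (# 0)) (f (# 1)) (f-edge _ _ refl)
           (f (# 2)) (f-edge _ _ refl) (f-edge _ _ refl)
           (f (# 3)) (f-edge _ _ refl) (f-edge _ _ refl)
           (f (# 4)) (f-edge _ _ refl) (f-edge _ _ refl)
  ... | inj₁ eq        with () ← f-inj eq
  ... | inj₂ (inj₁ eq) with () ← f-inj eq
  ... | inj₂ (inj₂ eq) with () ← f-inj eq

  CommonNeighboursIndependent : Set
  CommonNeighboursIndependent =
    ∀ a b → Edge G a b →
    ∀ x → Edge G a x → Edge G b x →
    ∀ y → Edge G a y → Edge G b y →
    ¬ Edge G x y

  commonNeighboursIndependent? : Dec CommonNeighboursIndependent
  commonNeighboursIndependent? =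
    all? λ a → all? λ b → edge? a b →-dec
    (all? λ x → edge? a x →-dec (edge? b x →-dec
    (all? λ y → edge? a y →-dec (edge? b y →-dec
    ¬? (edge? x y)))))

  commonNeighboursIndependent⇒K₄-free : CommonNeighboursIndependent → Free (K 4) G
  commonNeighboursIndependent⇒K₄-free h (f , _ , f-edge) =
    h (f (# 0)) (f (# 1)) (f-edge _ _ refl)
      (f (# 2)) (f-edge _ _ refl) (f-edge _ _ refl)
      (f (# 3)) (f-edge _ _ refl) (f-edge _ _ refl)
      (f-edge _ _ refl)

  ClosesTriangle : List (Fin n) → Fin n → Set
  ClosesTriangle xs v =
    Any (λ x → Edge G v x × Any (λ y → Edge G v y × Edge G x y) xs) xs

  closesTriangle? : ∀ xs v → Dec (ClosesTriangle xs v)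
  closesTriangle? xs v =
    any? (λ x → edge? v x ×-dec any? (λ y → edge? v y ×-dec edge? x y) xs) xs

  closesTriangle⇒monoTriangle : ∀ {c b xs v} → All (λ x → c x ≡ b) xs → c v ≡ b →
                                ClosesTriangle xs v → MonoTriangle G c
  closesTriangle⇒monoTriangle cxs cv closes
    with x , x∈xs , vx , any-y ← find closes
    with y , y∈xs , vy , xy ← find any-y
    = _ , x , y , vx , xy , vy
    , trans cv (sym (lookup cxs x∈xs))
    , trans (lookup cxs x∈xs) (sym (lookup cxs y∈xs))

  -- A closed search tree: `vs` is still uncoloured, `ts` and `fs` are the colour classes so far. A
  -- branch that exhausts `vs` has closed no triangle, hence the `⊥`.
  Refuted : (vs ts fs : List (Fin n)) → Set
  Refuted []       ts fs = ⊥
  Refuted (v ∷ vs) ts fs =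
    (ClosesTriangle ts v ⊎ Refuted vs (v ∷ ts) fs) ×
    (ClosesTriangle fs v ⊎ Refuted vs ts (v ∷ fs))

  refuted? : ∀ vs ts fs → Dec (Refuted vs ts fs)
  refuted? []       ts fs = no λ ()
  refuted? (v ∷ vs) ts fs =
    -- The subtree is evaluated only if the triangle test fails; this is the pruning.
    (closesTriangle? ts v ⊎-dec refuted? vs (v ∷ ts) fs) ×-dec
    (closesTriangle? fs v ⊎-dec refuted? vs ts (v ∷ fs))

  -- The colouring `c` selects one path through the tree, along which both lists stay correctly
  -- coloured; the path can only end at a closed triangle.
  refuted⇒monoTriangle : ∀ {c} vs {ts fs} → Refuted vs ts fs →
                         All (λ x → c x ≡ true) ts → All (λ x → c x ≡ false) fs →
                         MonoTriangle G c
  refuted⇒monoTriangle {c} (v ∷ vs) (rt , rf) cts cfs with c v in cv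
  ... | true  with rt
  ...   | inj₁ closes = closesTriangle⇒monoTriangle cts cv closes
  ...   | inj₂ r      = refuted⇒monoTriangle vs r (cv ∷ cts) cfs
  refuted⇒monoTriangle {c} (v ∷ vs) (rt , rf) cts cfs | false with rf
  ...   | inj₁ closes = closesTriangle⇒monoTriangle cfs cv closes
  ...   | inj₂ r      = refuted⇒monoTriangle vs r cts (cv ∷ cfs)

  refuted⇒arrows : ∀ vs → Refuted vs [] [] → Arrows33v G
  refuted⇒arrows vs r c = refuted⇒monoTriangle vs r [] []

-- Arguments: the orbits of the two vertices (0 for a, 1 for b, 2 for ∞) and the
-- difference modulo 9 of their indices.
orbitAdj : ℕ → ℕ → ℕ → Bool
orbitAdj 0 0 3 = true
orbitAdj 0 0 4 = true
orbitAdj 0 0 5 = true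
orbitAdj 0 0 6 = true
orbitAdj 0 1 0 = true
orbitAdj 0 1 1 = true
orbitAdj 0 1 4 = true
orbitAdj 1 0 0 = true
orbitAdj 1 0 8 = true
orbitAdj 1 0 5 = true
orbitAdj 1 1 1 = true
orbitAdj 1 1 8 = true
orbitAdj 1 2 _ = true
orbitAdj 2 1 _ = true
orbitAdj _ _ _ = false

adj₁₉ : Fin 19 → Fin 19 → Bool
-- Vertices 0-8 are the aᵢ, 9-17 the bᵢ and 18 is ∞. The added 9 keeps `∸` from truncating.
adj₁₉ i j = orbitAdj (u / 9) (v / 9) ((9 + v % 9 ∸ u % 9) % 9)
  where
  u = toℕ i
  v = toℕ j

G₁₉ : Graph 19
G₁₉ = record
  { adj        = adj₁₉
  -- The table lists differences in pairs d, -d modulo 9: 3 with 6, 4 with 5, 1 with 8; from b to a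
  -- they are 0, 8, 5, the negatives of 0, 1, 4.
  ; adj-sym    = toWitness {a? = all? λ i → all? λ j → adj₁₉ i j Bool.≟ adj₁₉ j i} _
  ; adj-irrefl = toWitness {a? = all? λ i → adj₁₉ i i Bool.≟ false} _
  }

G₁₉-B₃-free : Free B₃ G₁₉
G₁₉-B₃-free = noThreeCommonNeighbours⇒B₃-free G₁₉
  (toWitness {a? = noThreeCommonNeighbours? G₁₉} _)

G₁₉-K₄-free : Free (K 4) G₁₉
G₁₉-K₄-free = commonNeighboursIndependent⇒K₄-free G₁₉
  (toWitness {a? = commonNeighboursIndependent? G₁₉} _)

G₁₉-arrows : Arrows33v G₁₉
G₁₉-arrows = refuted⇒arrows G₁₉ (allFin 19)
  (toWitness {a? = refuted? G₁₉ (allFin 19) [] []} _)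

theorem5 : Σ (Graph 19) (λ G → Free B₃ G × Free (K 4) G × Arrows33v G)
    × Σ ℕ (λ n → n ≤ 19 × Σ (Graph n) (λ G → Free B₃ G × Arrows33v G))
theorem5 =
  (G₁₉ , G₁₉-B₃-free , G₁₉-K₄-free , G₁₉-arrows) ,
  -- The least order of such a graph is at most that of any example, so `G₁₉` itself gives the
  -- bound.
  (19 , ≤-refl , G₁₉ , G₁₉-B₃-free , G₁₉-arrows)
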